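{- Let $n$ be a composite positive integer for which there exists a positive integer $M$ with $M\,S_2(n) = \phi(n) - 1$, where $\phi$ is Euler's totient function and $S_2(n) = n\prod_{p \mid n}\left(1 - \frac{2}{p}\right)$ (product over the distinct primes $p$ dividing $n$). Then $n$ is odd, $n$ is squarefree, and $\omega(n) \geq 7$, where $\omega(n)$ denotes the number of distinct prime divisors of $n$.
   Context: $S_2$ is Schemmel's totient function, $S_2(n) = n\prod_{p\mid n}(1-2/p)$. A composite integer $n$ satisfying $M S_2(n) = \phi(n)-1$ for some positive integer $M$ is called a Deaconescu number. $\omega(n)$ is the number of distinct prime factors of $n$. -}

module Defs where

open import Data.Nat using (ℕ; suc; _*_; _∸_; _/_; NonZero)
open import Data.Nat.Divisibility using (_∣_; _∣?_)
open import Data.Nat.Primality using (Prime; prime?)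
open import Data.Nat.Coprimality using (Coprime; coprime?)
open import Data.List using (List; filter; map; upTo; length)
open import Data.Nat.ListAction using (product)
open import Relation.Nullary using (¬_)
open import Relation.Nullary.Decidable using (_×-dec_)
open import Data.Product using (_×_)

range1 : ℕ → List ℕ
range1 n = map suc (upTo n)

φ : ℕ → ℕ
φ n = length (filter (λ k → coprime? k n) (range1 n))

primeDivisors : ℕ → List ℕ
primeDivisors n = filter (λ p → prime? p ×-dec (p ∣? n)) (range1 n)

ω : ℕ → ℕ
ω n = length (primeDivisors n)

-- Schemmel's totient S₂(n) = n ∏_{p ∣ n} (1 - 2/p) = n ∏ (p - 2) / ∏ p.
-- (∏ p divides n, so the division is exact; each p ≥ 2 so p ∸ 2 = p - 2.)
S₂ : ℕ → ℕ
S₂ n = (n * product (map (λ p → p ∸ 2) (primeDivisors n)))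
         / suc (product (primeDivisors n) ∸ 1)

SquareFree : ℕ → Set
SquareFree n = ∀ p → Prime p → ¬ (p * p ∣ n)

{-# OPTIONS --safe #-}

-- If n is even, S₂(n) = 0 forces φ(n) = 1, impossible for composite n.
-- If p² ∣ n, then p divides both S₂(n) and φ(n), hence p ∣ 1.
-- So n = p₁⋯p_k with odd primes p₁ < ⋯ < p_k, k ≥ 2, and the hypothesis
-- reads 1 + M ∏(pᵢ - 2) = ∏(pᵢ - 1).  As ∏(pᵢ - 1) is even, M is odd; M = 1
-- is impossible since k ≥ 2.  If k ≤ 6, then pᵢ ≥ 2i + 1 gives
-- ∏(pᵢ - 1)/(pᵢ - 2) < 5, so M = 3.  If 3 ∤ n, then pᵢ ≥ 2i + 3 and the same
-- product is below 3.  If 3 ∣ n, then modulo 3 we have 2 ∏_{i>1}(pᵢ - 1) ≡ 1,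
-- so pᵢ ≡ 2 for all i > 1 and the left side is 2, a contradiction.
module Submission where

open import Defs
open import Data.Bool using (if_then_else_; true; false)
open import Data.List using (List; []; _∷_; filter; map; applyUpTo; length)
open import Data.List.Membership.Propositional using (_∈_)
open import Data.List.Membership.Propositional.Properties using (∈-filter⁺; ∈-filter⁻; ∈-map⁺; ∈-upTo⁺)
open import Data.List.Relation.Unary.All as All using (All; []; _∷_)
open import Data.List.Relation.Unary.AllPairs using (AllPairs; []; _∷_)
import Data.List.Relation.Unary.AllPairs.Properties as AllPairs
open import Data.Nat using (ℕ; zero; suc; _+_; _*_; _∸_; _/_; _≤_; _<_; _≥_; z≤n; s≤s; s<s; NonZero; nonTrivial⇒n>1; >-nonZero)
open import Data.Nat.Coprimality as Coprimality using (Coprime; coprime?; coprime-divisor)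
open import Data.Nat.DivMod using (m*n/n≡m)
open import Data.Nat.Divisibility
open import Data.Nat.ListAction using (product)
open import Data.Nat.ListAction.Properties using (∈⇒∣product)
open import Data.Nat.Primality using (Prime; Composite; composite; prime?; prime[2]; ¬prime[0]; ¬prime[1]; euclidsLemma; prime⇒irreducible; prime⇒nonTrivial; composite⇒¬prime; productOfPrimes≢0)
open import Data.Nat.Primality.Factorisation using (factorise; factorisationHasAllPrimeFactors)
open import Data.Nat.Properties
open import Data.Nat.Tactic.RingSolver using (solve-∀)
open import Data.Product using (_×_; ∃-syntax; _,_; proj₁; proj₂)
open import Data.Sum using (_⊎_; inj₁; inj₂)
open import Function using (_∘_; id; it)
open import Relation.Binary.PropositionalEquality using (_≡_; _≢_; refl; sym; trans; cong; cong₂; subst; module ≡-Reasoning)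
open import Relation.Nullary using (¬_; Dec; yes; no; does; contradiction)
open import Relation.Nullary.Decidable using (_×-dec_; from-yes; from-no)
open import Relation.Unary using (Decidable)

-- Finite sums

∑< : ℕ → (ℕ → ℕ) → ℕ
∑< zero    f = 0
∑< (suc n) f = f 0 + ∑< n (f ∘ suc)

∑<-cong : ∀ n {f g : ℕ → ℕ} → (∀ i → f i ≡ g i) → ∑< n f ≡ ∑< n g
∑<-cong zero    f≗g = refl
∑<-cong (suc n) f≗g = cong₂ _+_ (f≗g 0) (∑<-cong n (f≗g ∘ suc))

∑<-zero : ∀ n {f : ℕ → ℕ} → (∀ {i} → i < n → f i ≡ 0) → ∑< n f ≡ 0
∑<-zero zero    f≡0 = refl
∑<-zero (suc n) f≡0 = cong₂ _+_ (f≡0 (s≤s z≤n)) (∑<-zero n (f≡0 ∘ s<s))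

∑<-+ : ∀ n (f g : ℕ → ℕ) → ∑< n (λ i → f i + g i) ≡ ∑< n f + ∑< n g
∑<-+ zero    f g = refl
∑<-+ (suc n) f g = trans (cong (f 0 + g 0 +_) (∑<-+ n (f ∘ suc) (g ∘ suc)))
                         (interchange (f 0) (g 0) _ _)
  where
  interchange : ∀ a b c d → (a + b) + (c + d) ≡ (a + c) + (b + d)
  interchange = solve-∀

∑<-split : ∀ m n (f : ℕ → ℕ) → ∑< (m + n) f ≡ ∑< m f + ∑< n (λ i → f (m + i))
∑<-split zero    n f = refl
∑<-split (suc m) n f = trans (cong (f 0 +_) (∑<-split m n (f ∘ suc)))
                             (sym (+-assoc (f 0) _ _))

∑<-periodic : ∀ k m (f : ℕ → ℕ) → (∀ i → f (m + i) ≡ f i) →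
              ∑< (k * m) f ≡ k * ∑< m f
∑<-periodic zero    m f per = refl
∑<-periodic (suc k) m f per = trans (∑<-split m (k * m) f)
  (cong (∑< m f +_) (trans (∑<-cong (k * m) per) (∑<-periodic k m f per)))

term≤∑< : ∀ {n i} (f : ℕ → ℕ) → i < n → f i ≤ ∑< n f
term≤∑< {suc n} {zero}  f _         = m≤m+n (f 0) _
term≤∑< {suc n} {suc i} f (s≤s i<n) = m≤n⇒m≤o+n (f 0) (term≤∑< (f ∘ suc) i<n)

-- Indicators and counting

𝟙 : ∀ {P : Set} → Dec P → ℕ
𝟙 P? = if does P? then 1 else 0

𝟙-cong : ∀ {P Q : Set} (P? : Dec P) (Q? : Dec Q) → (P → Q) → (Q → P) → 𝟙 P? ≡ 𝟙 Q?
𝟙-cong (yes p) (yes q) to from = refl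
𝟙-cong (yes p) (no ¬q) to from = contradiction (to p) ¬q
𝟙-cong (no ¬p) (yes q) to from = contradiction (from q) ¬p
𝟙-cong (no ¬p) (no ¬q) to from = refl

𝟙-true : ∀ {P : Set} (P? : Dec P) → P → 𝟙 P? ≡ 1
𝟙-true (yes _) p = refl
𝟙-true (no ¬p) p = contradiction p ¬p

𝟙-false : ∀ {P : Set} (P? : Dec P) → ¬ P → 𝟙 P? ≡ 0
𝟙-false (yes p) ¬p = contradiction p ¬p
𝟙-false (no _)  ¬p = refl

-- Turns counts such as `φ n` into sums of indicators, which can be split and compared termwise. The
-- extra function `h` absorbs the shift by `suc` in the induction.
length-filter-∑< : ∀ {P : ℕ → Set} (P? : Decidable P) (g h : ℕ → ℕ) n →
                   length (filter P? (map g (applyUpTo h n))) ≡ ∑< n (λ i → 𝟙 (P? (g (h i))))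
length-filter-∑< P? g h zero = refl
length-filter-∑< P? g h (suc n) with does (P? (g (h 0)))
... | true  = cong suc (length-filter-∑< P? g (h ∘ suc) n)
... | false = length-filter-∑< P? g (h ∘ suc) n

-- Cut the range into m blocks of length p. Since the summand is evaluated at `suc i`, only the last
-- index of each block meets a multiple of p.
∑<-multiples : ∀ p .{{_ : NonZero p}} m (g : ℕ → ℕ) →
               ∑< (m * p) (λ i → 𝟙 (p ∣? suc i) * g (suc i)) ≡ ∑< m (λ j → g (suc j * p))
∑<-multiples p         zero    g = refl
∑<-multiples p@(suc q) (suc m) g = begin
  ∑< (p + m * p) F                               ≡⟨ ∑<-split p (m * p) F ⟩
  ∑< p F + ∑< (m * p) (λ i → F (p + i))          ≡⟨ cong₂ _+_ block shifted ⟩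
  g (1 * p) + ∑< m (λ j → g (suc (suc j) * p))   ∎
  where
  open ≡-Reasoning
  F : ℕ → ℕ
  F i = 𝟙 (p ∣? suc i) * g (suc i)

  block : ∑< p F ≡ g (1 * p)
  block = begin
    ∑< p F                   ≡⟨ cong (λ k → ∑< k F) (+-comm 1 q) ⟩
    ∑< (q + 1) F             ≡⟨ ∑<-split q 1 F ⟩
    ∑< q F + (F (q + 0) + 0) ≡⟨ cong₂ _+_ (∑<-zero q λ i<q → cong (_* g _) (𝟙-false (p ∣? _) (>⇒∤ (s≤s i<q))))
                                          (trans (+-identityʳ _) (cong F (+-identityʳ q))) ⟩
    F q                      ≡⟨ cong (_* g p) (𝟙-true (p ∣? p) ∣-refl) ⟩
    1 * g p                  ≡⟨ *-identityˡ (g p) ⟩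
    g p                      ≡⟨ cong g (*-identityˡ p) ⟨
    g (1 * p)                ∎

  shifted : ∑< (m * p) (λ i → F (p + i)) ≡ ∑< m (λ j → g (suc (suc j) * p))
  shifted = trans
    (∑<-cong (m * p) λ i → trans (cong (λ k → 𝟙 (p ∣? k) * g k) (sym (+-suc p i)))
      (cong (_* g (p + suc i)) (𝟙-cong (p ∣? (p + suc i)) (p ∣? suc i) (λ d → ∣m+n∣m⇒∣n d ∣-refl) (∣m∣n⇒∣m+n ∣-refl))))
    (∑<-multiples p m (λ k → g (p + k)))

-- Euler's totient

coprime-∣ʳ : ∀ {k m n} → m ∣ n → Coprime k n → Coprime k m
coprime-∣ʳ m∣n c (d∣k , d∣m) = c (d∣k , ∣-trans d∣m m∣n)

prime∤⇒coprime : ∀ {p k} → Prime p → ¬ p ∣ k → Coprime k p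
prime∤⇒coprime pp p∤k (d∣k , d∣p) with prime⇒irreducible pp d∣p
... | inj₁ d≡1  = d≡1
... | inj₂ refl = contradiction d∣k p∤k

coprime-*ʳ : ∀ {k m n} → Coprime k m → Coprime k n → Coprime k (m * n)
coprime-*ʳ c c′ (d∣k , d∣mn) =
  c′ (d∣k , coprime-divisor (λ (e∣d , e∣m) → c (∣-trans e∣d d∣k , e∣m)) d∣mn)

coprimeTo : ℕ → ℕ → ℕ
coprimeTo m k = 𝟙 (coprime? k m)

φ-∑< : ∀ n → φ n ≡ ∑< n (coprimeTo n ∘ suc)
φ-∑< n = length-filter-∑< (λ k → coprime? k n) suc id n

-- Coprimality to m has period m, so k m consecutive integers make up k full periods.
φ-multiple : ∀ k m → ∑< (k * m) (coprimeTo m ∘ suc) ≡ k * φ m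
φ-multiple k m = trans (∑<-periodic k m (coprimeTo m ∘ suc) periodic) (cong (k *_) (sym (φ-∑< m)))
  where
  periodic : ∀ i → coprimeTo m (suc (m + i)) ≡ coprimeTo m (suc i)
  periodic i = trans (cong (coprimeTo m) (sym (+-suc m i)))
    (𝟙-cong (coprime? (m + suc i) m) (coprime? (suc i) m)
      (λ c (d∣i , d∣m) → c (∣m∣n⇒∣m+n d∣m d∣i , d∣m)) (Coprimality.coprime-+ {suc i} {m}))

φ≥1 : ∀ {n} → 1 ≤ n → 1 ≤ φ n
φ≥1 {n} 1≤n rewrite φ-∑< n =
  subst (_≤ ∑< n (coprimeTo n ∘ suc)) (𝟙-true (coprime? 1 n) (Coprimality.1-coprimeTo n))
        (term≤∑< (coprimeTo n ∘ suc) 1≤n)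

-- The integers 1 and n - 1 are both coprime to n, and n ≥ 3 makes them distinct.
φ≥2 : ∀ {n} → 3 ≤ n → 2 ≤ φ n
φ≥2 {n@(suc (suc (suc m)))} (s≤s (s≤s (s≤s z≤n))) rewrite φ-∑< n =
  +-mono-≤ (≤-reflexive (sym (𝟙-true (coprime? 1 n) (Coprimality.1-coprimeTo n))))
    (≤-trans (≤-reflexive (sym (𝟙-true (coprime? (suc (suc m)) n) pred-coprime)))
             (term≤∑< {i = m} (coprimeTo n ∘ suc ∘ suc) (m≤n⇒m≤1+n ≤-refl)))
  where
  pred-coprime : Coprime (suc (suc m)) n
  pred-coprime {d} (d∣n-1 , d∣n) = ∣1⇒≡1 (∣m+n∣m⇒∣n (subst (d ∣_) (+-comm 1 (suc (suc m))) d∣n) d∣n-1)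

-- When p divides m, being coprime to p m is the same as being coprime to m; it remains to count
-- over p periods.
φ-*-∣ : ∀ {p m} → p ∣ m → φ (p * m) ≡ p * φ m
φ-*-∣ {p} {m} p∣m = begin
  φ (p * m)                            ≡⟨ φ-∑< (p * m) ⟩
  ∑< (p * m) (coprimeTo (p * m) ∘ suc) ≡⟨ ∑<-cong (p * m) same ⟩
  ∑< (p * m) (coprimeTo m ∘ suc)       ≡⟨ φ-multiple p m ⟩
  p * φ m                              ∎
  where
  open ≡-Reasoning
  same : ∀ i → coprimeTo (p * m) (suc i) ≡ coprimeTo m (suc i)
  same i = 𝟙-cong (coprime? (suc i) (p * m)) (coprime? (suc i) m) (coprime-∣ʳ (n∣m*n p))
                  (λ c → coprime-*ʳ (coprime-∣ʳ p∣m c) c)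

-- Of the p φ(m) residues modulo p m that are coprime to m, exactly φ(m) are
-- multiples of p.
φ-*-∤ : ∀ {p m} → Prime p → ¬ p ∣ m → φ (p * m) ≡ (p ∸ 1) * φ m
φ-*-∤ {zero}  {m} pp p∤m = contradiction pp ¬prime[0]
-- Adding φ(m) to both sides avoids subtraction: the added term counts the multiples of p that are
-- coprime to m.
φ-*-∤ {p@(suc q)} {m} pp p∤m = +-cancelʳ-≡ (φ m) _ _ (begin
  φ (p * m) + φ m
    ≡⟨ cong₂ _+_ (φ-∑< (p * m)) (trans (φ-∑< m) (∑<-cong m (λ j → sym (unscale (suc j))))) ⟩
  ∑< (p * m) (coprimeTo (p * m) ∘ suc) + ∑< m (λ j → coprimeTo m (suc j * p))
    ≡⟨ cong (∑< (p * m) (coprimeTo (p * m) ∘ suc) +_)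
            (trans (sym (∑<-multiples p m (coprimeTo m))) (cong (λ k → ∑< k F) (*-comm m p))) ⟩
  ∑< (p * m) (coprimeTo (p * m) ∘ suc) + ∑< (p * m) F
    ≡⟨ ∑<-+ (p * m) _ _ ⟨
  ∑< (p * m) (λ i → coprimeTo (p * m) (suc i) + F i)
    ≡⟨ ∑<-cong (p * m) (λ i → partition (suc i)) ⟩
  ∑< (p * m) (coprimeTo m ∘ suc)
    ≡⟨ φ-multiple p m ⟩
  φ m + q * φ m
    ≡⟨ +-comm (φ m) _ ⟩
  q * φ m + φ m ∎)
  where
  open ≡-Reasoning
  F : ℕ → ℕ
  F i = 𝟙 (p ∣? suc i) * coprimeTo m (suc i)

  unscale : ∀ k → coprimeTo m (k * p) ≡ coprimeTo m k
  unscale k = 𝟙-cong (coprime? (k * p) m) (coprime? k m)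
    (λ c → Coprimality.sym (coprime-∣ʳ (m∣m*n p) (Coprimality.sym c)))
    (λ c → Coprimality.sym (coprime-*ʳ (Coprimality.sym c) (prime∤⇒coprime pp p∤m)))

  partition : ∀ k → coprimeTo (p * m) k + 𝟙 (p ∣? k) * coprimeTo m k ≡ coprimeTo m k
  partition k with p ∣? k
  ... | yes p∣k = cong₂ _+_
    (𝟙-false (coprime? k (p * m)) (λ c → ¬prime[1] (subst Prime (c (p∣k , m∣m*n m)) pp)))
    (trans (cong (_* coprimeTo m k) (𝟙-true (p ∣? k) p∣k)) (*-identityˡ (coprimeTo m k)))
  ... | no  p∤k = trans
    (trans (cong (λ i → coprimeTo (p * m) k + i * coprimeTo m k) (𝟙-false (p ∣? k) p∤k)) (+-identityʳ _))
    (𝟙-cong (coprime? k (p * m)) (coprime? k m) (coprime-∣ʳ (n∣m*n p)) (coprime-*ʳ (prime∤⇒coprime pp p∤k)))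

-- Increasing lists of primes

∏[p-1] ∏[p-2] : List ℕ → ℕ
∏[p-1] ps = product (map (_∸ 1) ps)
∏[p-2] ps = product (map (_∸ 2) ps)

smaller-prime∤product : ∀ {p ps} → Prime p → All Prime ps → All (p <_) ps → ¬ p ∣ product ps
smaller-prime∤product pp pps p<ps p∣ =
  <-irrefl refl (All.lookup p<ps (factorisationHasAllPrimeFactors pp p∣ pps))

φ-product : ∀ {ps} → All Prime ps → AllPairs _<_ ps → φ (product ps) ≡ ∏[p-1] ps
φ-product []         []         = refl
φ-product {p ∷ ps} (pp ∷ pps) (p<ps ∷ <ps) =
  trans (φ-*-∤ pp (smaller-prime∤product pp pps p<ps)) (cong ((p ∸ 1) *_) (φ-product pps <ps))

-- If n = q · ∏ ps, the new prime p divides n but not ∏ ps, whose prime factors all exceed p; hence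
-- p divides q.
product-∣ : ∀ {n ps} → All Prime ps → AllPairs _<_ ps → All (_∣ n) ps → product ps ∣ n
product-∣ {n} [] [] [] = 1∣ n
product-∣ {n} {p ∷ ps} (pp ∷ pps) (p<ps ∷ <ps) (p∣n ∷ ps∣n)
  with divides q refl ← product-∣ pps <ps ps∣n
  with euclidsLemma q (product ps) pp p∣n
... | inj₁ p∣q = *-monoˡ-∣ (product ps) p∣q
... | inj₂ p∣∏ = contradiction p∣∏ (smaller-prime∤product pp pps p<ps)

-- Prime divisors, the radical and Schemmel's totient

primeDivisors-< : ∀ n → AllPairs _<_ (primeDivisors n)
primeDivisors-< n = AllPairs.filter⁺ _ (AllPairs.map⁺ (AllPairs.applyUpTo⁺₁ id n λ i<j _ → s≤s i<j))

∈-primeDivisors⁻ : ∀ {n p} → p ∈ primeDivisors n → Prime p × p ∣ n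
∈-primeDivisors⁻ {n} p∈ = proj₂ (∈-filter⁻ (λ p → prime? p ×-dec (p ∣? n)) {xs = range1 n} p∈)

∈-primeDivisors⁺ : ∀ {n p} .{{_ : NonZero n}} → Prime p → p ∣ n → p ∈ primeDivisors n
∈-primeDivisors⁺ {n} {zero}  pp p∣n = contradiction pp ¬prime[0]
∈-primeDivisors⁺ {n} {suc p} pp p∣n =
  ∈-filter⁺ (λ p → prime? p ×-dec (p ∣? n)) (∈-map⁺ suc (∈-upTo⁺ (∣⇒≤ p∣n))) (pp , p∣n)

primeDivisors-prime : ∀ n → All Prime (primeDivisors n)
primeDivisors-prime n = All.tabulate (proj₁ ∘ ∈-primeDivisors⁻ {n})

-- The product is the radical of n. Allowing m other than n serves the case p² ∣ n, where m = n/p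
-- still has all the primes of n.
radical-∣ : ∀ {n m} → (∀ {p} → Prime p → p ∣ n → p ∣ m) → product (primeDivisors n) ∣ m
radical-∣ {n} ∣m = product-∣ (primeDivisors-prime n) (primeDivisors-< n)
  (All.tabulate λ p∈ → let pp , p∣n = ∈-primeDivisors⁻ {n} p∈ in ∣m pp p∣n)

-- The radical R is a product of primes, hence nonzero, so the divisor `suc (R ∸ 1)` in `S₂` is R
-- itself and cancels exactly.
S₂-quotient : ∀ {n} q → n ≡ q * product (primeDivisors n) → S₂ n ≡ q * ∏[p-2] (primeDivisors n)
S₂-quotient {n} q eq = begin
  n * B / suc (R ∸ 1)       ≡⟨ cong (λ k → k * B / suc (R ∸ 1)) eq ⟩
  q * R * B / suc (R ∸ 1)   ≡⟨ cong (_/ suc (R ∸ 1)) (swap q R B) ⟩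
  q * B * R / suc (R ∸ 1)   ≡⟨ cong (λ k → q * B * k / suc (R ∸ 1)) (sym 1+[R-1]≡R) ⟩
  q * B * suc (R ∸ 1) / suc (R ∸ 1) ≡⟨ m*n/n≡m (q * B) (suc (R ∸ 1)) ⟩
  q * B                     ∎
  where
  open ≡-Reasoning
  R B : ℕ
  R = product (primeDivisors n)
  B = ∏[p-2] (primeDivisors n)

  swap : ∀ a b c → a * b * c ≡ a * c * b
  swap = solve-∀

  1+[R-1]≡R : suc (R ∸ 1) ≡ R
  1+[R-1]≡R = suc-pred R {{productOfPrimes≢0 (primeDivisors-prime n)}}

prime-divisor : ∀ n .{{_ : NonZero n}} → n ≡ 1 ⊎ ∃[ p ] (Prime p × p ∣ n)
prime-divisor n with factorise n
... | record { factors = []     ; isFactorisation = n≡1 } = inj₁ n≡1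
... | record { factors = p ∷ ps ; isFactorisation = n≡∏ ; factorsPrime = pp ∷ _ } =
  inj₂ (p , pp , subst (p ∣_) (sym n≡∏) (m∣m*n (product ps)))

-- Write n = q · rad(n). A prime dividing q would also divide rad(n), so its square would divide n;
-- hence q = 1.
squareFree⇒radical≡ : ∀ {n} .{{_ : NonZero n}} → SquareFree n → n ≡ product (primeDivisors n)
squareFree⇒radical≡ {n} sf with radical-∣ {n} {n} (λ _ p∣n → p∣n)
... | divides q eq with prime-divisor q {{quotient≢0 (divides q eq)}}
...   | inj₁ refl = trans eq (*-identityˡ _)
...   | inj₂ (p , pp , p∣q) = contradiction
  (subst (p * p ∣_) (sym eq)
    (*-pres-∣ p∣q (∈⇒∣product (∈-primeDivisors⁺ pp (subst (p ∣_) (sym eq) (∣m⇒∣m*n _ p∣q))))))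
  (sf p pp)

-- Bounds for ∏ (p - 1)/(p - 2)

-- This is b(b + 2)(b + 4)⋯ with k factors. The quotient of its values at b + 1 and b is ∏ (p -
-- 1)/(p - 2) over p = b + 2, b + 4, ..., the extremal case below.
∏step2 : ℕ → ℕ → ℕ
∏step2 b zero    = 1
∏step2 b (suc k) = b * ∏step2 (2 + b) k

∏step2-suc-≤ : ∀ b k → ∏step2 b k ≤ ∏step2 (suc b) k
∏step2-suc-≤ b zero    = ≤-refl
∏step2-suc-≤ b (suc k) = *-mono-≤ (n≤1+n b) (∏step2-suc-≤ (2 + b) k)

∏step2≢0 : ∀ b k .{{_ : NonZero b}} → NonZero (∏step2 b k)
∏step2≢0 b zero    = _
∏step2≢0 b (suc k) = m*n≢0 b (∏step2 (2 + b) k) {{it}} {{∏step2≢0 (2 + b) k}}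

-- The i-th entry is at least b + 2i and (p - 1)/(p - 2) decreases in p, so consecutive odd numbers
-- are the worst case. Lists shorter than k only lose factors (b + 1)/b > 1. The inequality is
-- cross-multiplied to stay in ℕ.
ratio-bound : ∀ k b {ps} → length ps ≤ k → AllPairs _<_ ps → All (λ p → ¬ 2 ∣ p) ps →
              2 ∣ suc b → All (2 + b ≤_) ps →
              ∏[p-1] ps * ∏step2 b k ≤ ∏[p-2] ps * ∏step2 (suc b) k
ratio-bound k       b {[]} _ _ _ _ _ = *-monoʳ-≤ 1 (∏step2-suc-≤ b k)
ratio-bound (suc k) b {suc (suc y) ∷ ps} (s≤s len) (p<ps ∷ <ps) (_ ∷ odd) 2∣1+b (s≤s (s≤s b≤y) ∷ _) = begin
  suc y * ∏[p-1] ps * (b * ∏step2 (2 + b) k)       ≡⟨ [m*n]*[o*p]≡[m*o]*[n*p] (suc y) (∏[p-1] ps) b (∏step2 (2 + b) k) ⟩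
  suc y * b * (∏[p-1] ps * ∏step2 (2 + b) k)       ≤⟨ *-mono-≤ cross (ratio-bound k (2 + b) len <ps odd (∣m∣n⇒∣m+n ∣-refl 2∣1+b) bigger) ⟩
  y * suc b * (∏[p-2] ps * ∏step2 (3 + b) k)       ≡⟨ [m*n]*[o*p]≡[m*o]*[n*p] y (suc b) (∏[p-2] ps) (∏step2 (3 + b) k) ⟩
  y * ∏[p-2] ps * (suc b * ∏step2 (3 + b) k)       ∎
  where
  open ≤-Reasoning
  cross : suc y * b ≤ y * suc b
  cross = ≤-trans (+-monoˡ-≤ (y * b) b≤y) (≤-reflexive (sym (*-suc y b)))

  -- Later entries exceed p ≥ 2 + b, and they differ from 3 + b because that number is even.
  bigger : All (4 + b ≤_) ps
  bigger = All.zipWith (λ (p<q , odd-q) → ≤∧≢⇒< (≤-trans (s≤s (s≤s (s≤s b≤y))) p<q)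
      (λ { refl → odd-q (∣m∣n⇒∣m+n ∣-refl 2∣1+b) })) (p<ps , odd)

-- Reduces the exclusion of M to one numerical comparison of the two extremal products.
ratio-too-small : ∀ k b M {ps} .{{_ : NonZero b}} → ∏step2 (suc b) k ≤ M * ∏step2 b k →
                  length ps ≤ k → AllPairs _<_ ps → All (λ p → ¬ 2 ∣ p) ps →
                  2 ∣ suc b → All (2 + b ≤_) ps → ¬ M * ∏[p-2] ps < ∏[p-1] ps
ratio-too-small k b M {ps} N≤MD len <ps odd 2∣1+b b≤ps MB<A = <-irrefl refl (begin-strict
  M * B * D             <⟨ *-monoˡ-< D {{∏step2≢0 b k}} MB<A ⟩
  ∏[p-1] ps * D         ≤⟨ ratio-bound k b len <ps odd 2∣1+b b≤ps ⟩
  B * ∏step2 (suc b) k ≤⟨ *-monoʳ-≤ B N≤MD ⟩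
  B * (M * D)           ≡⟨ swap B M D ⟩
  M * B * D             ∎)
  where
  open ≤-Reasoning
  B D : ℕ
  B = ∏[p-2] ps
  D = ∏step2 b k
  swap : ∀ b m d → b * (m * d) ≡ m * b * d
  swap = solve-∀

∏[p-2]<∏[p-1] : ∀ {ps} → 1 ≤ length ps → All (3 ≤_) ps → ∏[p-2] ps < ∏[p-1] ps
∏[p-2]<∏[p-1] {_ ∷ []}               _ (s≤s (s≤s _) ∷ _) = ≤-refl
∏[p-2]<∏[p-1] {suc (suc y) ∷ q ∷ ps} _ (s≤s (s≤s _) ∷ 3≤ps) =
  ≤-<-trans (*-monoʳ-≤ y (<⇒≤ ih)) (m<n+m _ (≤-trans (s≤s z≤n) ih))
  where ih = ∏[p-2]<∏[p-1] {q ∷ ps} (s≤s z≤n) 3≤ps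

-- Excludes M = 1. Two primes are needed, since a single one gives equality.
1+∏[p-2]<∏[p-1] : ∀ {ps} → 2 ≤ length ps → All (3 ≤_) ps → suc (∏[p-2] ps) < ∏[p-1] ps
1+∏[p-2]<∏[p-1] {suc (suc (suc y)) ∷ ps} (s≤s 1≤len) (s≤s (s≤s (s≤s z≤n)) ∷ 3≤ps) = begin-strict
  suc (suc y * B)           <⟨ s≤s (s≤s (m≤m+n (suc y * B) (y + B))) ⟩
  2 + (suc y * B + (y + B)) ≡⟨ expand y B ⟨
  (2 + y) * suc B           ≤⟨ *-monoʳ-≤ (2 + y) (∏[p-2]<∏[p-1] 1≤len 3≤ps) ⟩
  (2 + y) * ∏[p-1] ps       ∎
  where
  open ≤-Reasoning
  B = ∏[p-2] ps
  expand : ∀ y b → (2 + y) * suc b ≡ 2 + (suc y * b + (y + b))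
  expand = solve-∀

-- The equation 1 + M ∏ (p - 2) = ∏ (p - 1)

-- The cases are n ≡ 0, 1, 2 (mod 3), in this order.
residue₃ : ∀ n → 3 ∣ n ⊎ 3 ∣ 2 + n ⊎ 3 ∣ 1 + n
residue₃ zero = inj₁ (3 ∣0)
residue₃ (suc n) with residue₃ n
... | inj₁ 3∣n          = inj₂ (inj₁ (∣m∣n⇒∣m+n ∣-refl 3∣n))
... | inj₂ (inj₁ 3∣2+n) = inj₂ (inj₂ 3∣2+n)
... | inj₂ (inj₂ 3∣1+n) = inj₁ 3∣1+n

-- 3 ∣ 2 + n encodes n ≡ 1 (mod 3).
∏[p-1]-mod-3 : ∀ {ps} → All Prime ps → All (3 <_) ps → 3 ∣ ∏[p-1] ps ⊎ 3 ∣ 2 + ∏[p-1] ps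
∏[p-1]-mod-3 [] [] = inj₂ ∣-refl
∏[p-1]-mod-3 {suc n ∷ ps} (pp ∷ pps) (3<p ∷ 3<ps) with residue₃ n | ∏[p-1]-mod-3 pps 3<ps
... | inj₁ 3∣n          | _           = inj₁ (∣m⇒∣m*n _ 3∣n)
-- Here p - 1 ≡ 2, so 3 divides p, which forces p = 3 against 3 < p.
... | inj₂ (inj₂ 3∣p)   | _ with prime⇒irreducible pp 3∣p
...   | inj₂ 3≡p = contradiction 3≡p (<⇒≢ 3<p)
∏[p-1]-mod-3 {suc n ∷ ps} (pp ∷ pps) (3<p ∷ 3<ps)
    | inj₂ (inj₁ 3∣2+n) | inj₁ 3∣∏   = inj₁ (∣n⇒∣m*n n 3∣∏)
∏[p-1]-mod-3 {suc n ∷ ps} (pp ∷ pps) (3<p ∷ 3<ps)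
    | inj₂ (inj₁ 3∣2+n) | inj₂ 3∣2+∏ = inj₂ (∣m+n∣m⇒∣n
  -- Both factors are ≡ 1. Adding 6, a multiple of 3, balances the constants so that the identity
  -- needs no subtraction.
  (subst (3 ∣_) (expand n (∏[p-1] ps)) (∣m∣n⇒∣m+n (∣m⇒∣m*n (2 + ∏[p-1] ps) 3∣2+n) (divides 2 refl)))
  (∣m∣n⇒∣m+n (∣n⇒∣m*n 2 3∣2+n) (∣n⇒∣m*n 2 3∣2+∏)))
  where
  expand : ∀ n a → (2 + n) * (2 + a) + 6 ≡ (2 * (2 + n) + 2 * (2 + a)) + (2 + n * a)
  expand = solve-∀

prime∣n⇒∤1+n : ∀ {p n} → Prime p → p ∣ n → ¬ p ∣ suc n
prime∣n⇒∤1+n {p} {n} pp p∣n p∣1+n =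
  ¬prime[1] (subst Prime (∣1⇒≡1 (∣m+n∣m⇒∣n (subst (p ∣_) (+-comm 1 n) p∣1+n) p∣n)) pp)

odd⇒2∣pred : ∀ {n} → ¬ 2 ∣ n → 2 ∣ n ∸ 1
odd⇒2∣pred {0} odd = 2 ∣0
odd⇒2∣pred {1} odd = 2 ∣0
odd⇒2∣pred {2} odd = contradiction ∣-refl odd
odd⇒2∣pred {suc (suc (suc n))} odd = ∣m∣n⇒∣m+n ∣-refl (odd⇒2∣pred {suc n} (odd ∘ ∣m∣n⇒∣m+n ∣-refl))

prime[3] : Prime 3
prime[3] = from-yes (prime? 3)

odd-prime≥3 : ∀ {p} → Prime p → ¬ 2 ∣ p → 3 ≤ p
odd-prime≥3 pp odd = ≤∧≢⇒< (nonTrivial⇒n>1 _ {{prime⇒nonTrivial pp}}) (λ { refl → odd ∣-refl })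

≥3⇒≡3∨≥5 : ∀ {p} → ¬ 2 ∣ p → 3 ≤ p → p ≡ 3 ⊎ 5 ≤ p
≥3⇒≡3∨≥5 {3} odd _ = inj₁ refl
≥3⇒≡3∨≥5 {4} odd _ = contradiction (divides 2 refl) odd
≥3⇒≡3∨≥5 {suc (suc (suc (suc (suc p))))} odd _ = inj₂ (s≤s (s≤s (s≤s (s≤s (s≤s z≤n)))))
≥3⇒≡3∨≥5 {1} odd (s≤s ())
≥3⇒≡3∨≥5 {2} odd (s≤s (s≤s ()))

no-small-solution : ∀ {ps} → All Prime ps → AllPairs _<_ ps → All (λ p → ¬ 2 ∣ p) ps →
                    2 ≤ length ps → length ps ≤ 6 →
                    ∀ M → M ≥ 1 → suc (M * ∏[p-2] ps) ≢ ∏[p-1] ps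
no-small-solution {ps@(p ∷ qs)} pps@(pp ∷ qqs) <ps@(p<qs ∷ _) odd@(odd-p ∷ _) 2≤len len≤6 = go
  where
  B = ∏[p-2] ps

  3≤ps : All (3 ≤_) ps
  3≤ps = All.zipWith (λ (pp , odd) → odd-prime≥3 pp odd) (pps , odd)

  2∣∏[p-1] : 2 ∣ ∏[p-1] ps
  2∣∏[p-1] = ∣m⇒∣m*n (∏[p-1] qs) (odd⇒2∣pred odd-p)

  even-M : ∀ {M} → 2 ∣ M → suc (M * B) ≢ ∏[p-1] ps
  even-M 2∣M eq = prime∣n⇒∤1+n prime[2] (∣m⇒∣m*n B 2∣M) (subst (2 ∣_) (sym eq) 2∣∏[p-1])

  go : ∀ M → M ≥ 1 → suc (M * B) ≢ ∏[p-1] ps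
  go 1 _ eq = <-irrefl (trans (cong suc (sym (*-identityˡ B))) eq) (1+∏[p-2]<∏[p-1] 2≤len 3≤ps)
  go 2 _ = even-M ∣-refl
  go 4 _ = even-M (divides 2 refl)
  go 3 _ eq with ≥3⇒≡3∨≥5 odd-p (All.head 3≤ps)
  -- With b = 3 the primes start at 5: 4·6·8·10·12·14 < 3 · (3·5·7·9·11·13).
  ... | inj₂ 5≤p = ratio-too-small 6 3 3 (≤ᵇ⇒≤ (∏step2 4 6) (3 * ∏step2 3 6) _)
    len≤6 <ps odd (divides 2 refl) (5≤p ∷ All.map (≤-trans 5≤p ∘ <⇒≤) p<qs) (≤-reflexive eq)
  ... | inj₁ refl with ∏[p-1]-mod-3 qqs p<qs
  -- Now p = 3, so ∏(p - 1) is twice the product over `qs`. If 3 divides it, then 3 divides both 3B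
  -- and 1 + 3B.
  ...   | inj₁ 3∣∏   = prime∣n⇒∤1+n prime[3] (m∣m*n B) (subst (3 ∣_) (sym eq) (∣n⇒∣m*n 2 3∣∏))
  -- If the product over `qs` is ≡ 1, doubling turns the equation into 3 ∣ 3B + 5, hence 3 ∣ 5.
  ...   | inj₂ 3∣2+∏ = from-no (3 ∣? 5) (∣m+n∣m⇒∣n (subst (3 ∣_) double (∣n⇒∣m*n 2 3∣2+∏)) (m∣m*n B))
    where
    open ≡-Reasoning
    double : 2 * (2 + ∏[p-1] qs) ≡ 3 * B + 5
    double = begin
      2 * (2 + ∏[p-1] qs) ≡⟨ *-distribˡ-+ 2 2 (∏[p-1] qs) ⟩
      4 + 2 * ∏[p-1] qs   ≡⟨ cong (4 +_) eq ⟨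
      5 + 3 * B           ≡⟨ +-comm 5 (3 * B) ⟩
      3 * B + 5           ∎
  -- All M ≥ 5 at once, with b = 1 and primes from 3: 2·4·6·8·10·12 < 5 · (1·3·5·7·9·11).
  go (suc (suc (suc (suc (suc M))))) _ eq = ratio-too-small 6 1 5 (≤ᵇ⇒≤ (∏step2 2 6) (5 * ∏step2 1 6) _)
    len≤6 <ps odd ∣-refl 3≤ps
    (≤-trans (s≤s (*-monoˡ-≤ B (m≤m+n 5 M))) (≤-reflexive eq))

-- Excluding even and non-squarefree n

∈⇒product≡0 : ∀ {xs} → 0 ∈ xs → product xs ≡ 0
∈⇒product≡0 0∈xs = 0∣⇒≡0 (∈⇒∣product 0∈xs)

-- The factor p - 2 vanishes at p = 2.
2∣n⇒S₂≡0 : ∀ {n} .{{_ : NonZero n}} → 2 ∣ n → S₂ n ≡ 0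
2∣n⇒S₂≡0 {n} 2∣n with radical-∣ {n} {n} (λ _ p∣n → p∣n)
... | divides q eq = trans (S₂-quotient q eq)
  (trans (cong (q *_) (∈⇒product≡0 (∈-map⁺ (_∸ 2) (∈-primeDivisors⁺ prime[2] 2∣n)))) (*-zeroʳ q))

-- If n = k p², then k p has all the primes of n, so rad(n) divides it. Thus n = p q · rad(n), and
-- the factor p survives in `S₂ n`.
p*p∣n⇒p∣S₂ : ∀ {n p} → Prime p → p * p ∣ n → p ∣ S₂ n
p*p∣n⇒p∣S₂ {n} {p} pp (divides k eq) with radical-∣ {n} {k * p} same-primes
  where
  same-primes : ∀ {r} → Prime r → r ∣ n → r ∣ k * p
  same-primes {r} rr r∣n with euclidsLemma (k * p) p rr (subst (r ∣_) (trans eq (sym (*-assoc k p p))) r∣n)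
  ... | inj₁ r∣kp = r∣kp
  ... | inj₂ r∣p  = ∣n⇒∣m*n k r∣p
... | divides q eq′ = subst (p ∣_) (sym (S₂-quotient (p * q) n≡pqR)) (∣m⇒∣m*n _ (m∣m*n q))
  where
  n≡pqR : n ≡ p * q * product (primeDivisors n)
  n≡pqR = begin
    n           ≡⟨ eq ⟩
    k * (p * p) ≡⟨ *-assoc k p p ⟨
    k * p * p   ≡⟨ *-comm (k * p) p ⟩
    p * (k * p) ≡⟨ cong (p *_) eq′ ⟩
    p * (q * product (primeDivisors n)) ≡⟨ *-assoc p q _ ⟨
    p * q * product (primeDivisors n)   ∎
    where open ≡-Reasoning

p*p∣n⇒p∣φ : ∀ {n p} → p * p ∣ n → p ∣ φ n
p*p∣n⇒p∣φ {n} {p} (divides k eq) =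
  subst (p ∣_) (sym (trans (cong φ n≡) (φ-*-∣ {p} {k * p} (n∣m*n k)))) (m∣m*n (φ (k * p)))
  where
  n≡ : n ≡ p * (k * p)
  n≡ = trans eq (trans (sym (*-assoc k p p)) (*-comm (k * p) p))

composite≥3 : ∀ {n} → Composite n → 3 ≤ n
composite≥3 (composite {d} d<n _) = ≤-trans (s≤s (nonTrivial⇒n>1 d)) d<n

composite⇒2≤length : ∀ {ps} → All Prime ps → Composite (product ps) → 2 ≤ length ps
composite⇒2≤length {[]}        _        c = contradiction (composite≥3 c) (from-no (3 ≤? 1))
composite⇒2≤length {p ∷ []}    (pp ∷ _) c =
  contradiction (subst Prime (sym (*-identityʳ p)) pp) (composite⇒¬prime c)
composite⇒2≤length {_ ∷ _ ∷ _} _        _ = s≤s (s≤s z≤n)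

theorem1p1 : (n : ℕ) → Composite n →
    ∃[ M ] (M ≥ 1 × M * S₂ n ≡ φ n ∸ 1) →
    ¬ (2 ∣ n) × SquareFree n × ω n ≥ 7
theorem1p1 n n-composite (M , M≥1 , MS₂≡φ-1) = odd , squareFree , ω≥7
  where
  3≤n : 3 ≤ n
  3≤n = composite≥3 n-composite

  instance
    n≢0 : NonZero n
    n≢0 = >-nonZero (≤-trans (s≤s z≤n) 3≤n)

  1+MS₂≡φ : suc (M * S₂ n) ≡ φ n
  -- φ(n) ≥ 1 is what makes the truncated `φ n ∸ 1` a true subtraction.
  1+MS₂≡φ = trans (cong suc MS₂≡φ-1) (m+[n∸m]≡n (φ≥1 (≤-trans (s≤s z≤n) 3≤n)))

  odd : ¬ 2 ∣ n
  odd 2∣n = <⇒≢ (φ≥2 3≤n) (trans (cong suc (sym M*S₂≡0)) 1+MS₂≡φ)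
    where
    M*S₂≡0 : M * S₂ n ≡ 0
    M*S₂≡0 = trans (cong (M *_) (2∣n⇒S₂≡0 2∣n)) (*-zeroʳ M)

  squareFree : SquareFree n
  squareFree p pp p²∣n = prime∣n⇒∤1+n pp (∣n⇒∣m*n M (p*p∣n⇒p∣S₂ pp p²∣n))
    (subst (p ∣_) (sym 1+MS₂≡φ) (p*p∣n⇒p∣φ p²∣n))

  ps : List ℕ
  ps = primeDivisors n

  n≡∏ps : n ≡ product ps
  n≡∏ps = squareFree⇒radical≡ squareFree

  equation : suc (M * ∏[p-2] ps) ≡ ∏[p-1] ps
  equation = begin
    -- As n equals its radical, the quotient in `S₂-quotient` is 1.
    suc (M * ∏[p-2] ps) ≡⟨ cong (λ s → suc (M * s)) (trans (S₂-quotient 1 (trans n≡∏ps (sym (*-identityˡ _)))) (*-identityˡ _)) ⟨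
    suc (M * S₂ n)      ≡⟨ 1+MS₂≡φ ⟩
    φ n                 ≡⟨ cong φ n≡∏ps ⟩
    φ (product ps)      ≡⟨ φ-product (primeDivisors-prime n) (primeDivisors-< n) ⟩
    ∏[p-1] ps           ∎
    where open ≡-Reasoning

  ω≥7 : ω n ≥ 7
  ω≥7 = ≰⇒> λ ω≤6 → no-small-solution (primeDivisors-prime n) (primeDivisors-< n)
    (All.tabulate λ p∈ 2∣p → odd (∣-trans 2∣p (proj₂ (∈-primeDivisors⁻ {n} p∈))))
    (composite⇒2≤length (primeDivisors-prime n) (subst Composite n≡∏ps n-composite))
    ω≤6 M M≥1 equation
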